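{- For any $(j,S,c)$ skeleton construction with support $U$, let $p(U)$ be the minimum number of proper boxes of $\{0,1,2\}^j$ that partition $U$. Then $p(U)+c\ge 2^j$. Consequently $$S+c\ \ge\ 2^j+\bigl(S-p(U)\bigr),$$ and any skeleton construction with $S+c\le 2^j$ must satisfy $p(U)\ge S$.
   Context: Write $[3]=\{0,1,2\}$. A proper box in $[3]^j$ is a set $S_1\times\dots\times S_j$ with $\varnothing\neq S_i\subsetneq[3]$ for every $i$. For $t\in[3]^j$ the all-pair box of $t$ is $A_t=\prod_{i=1}^j([3]\setminus\{t_i\})$. A $(j,S,c)$ skeleton construction consists of a set $T\subseteq[3]^j$ with $|T|=S$ such that $N(x)=\#\{t\in T: x\in A_t\}\in\{0,2\}$ for all $x\in[3]^j$, together with $c$ proper boxes of $[3]^j$ that partition the hole-set $H=\{x: N(x)=0\}$ (pairwise disjoint with union $H$). Its support is $U=\{x: N(x)=2\}$. A family of boxes partitions a set if the boxes are pairwise disjoint with union that set. The theorem of Alon, Bohman, Holzman and Kleitman states that any partition of $[3]^j$ into proper boxes has at least $2^j$ members. -}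

module Defs where

open import Level using (0ℓ)
open import Data.Nat using (ℕ; zero; suc; _≤_; z≤n; s≤s; _≟_)
open import Data.Fin using (Fin)
import Data.Fin.Properties as Fin
open import Data.Fin.Subset using (Subset; ⁅_⁆; ∁; Nonempty) renaming
  (_∈_ to _∈ˢ_; _⊂_ to _⊂ˢ_; ⊤ to full)
open import Data.Fin.Subset.Properties using
  (_∈?_; _⊂?_; nonempty?; anySubset?; x∈⁅x⁆; x∈⁅y⁆⇒x≡y; ∈⊤)
open import Data.List using (List; []; _∷_; length; filter; cartesianProductWith; allFin)
open import Data.List.Membership.Propositional using (_∈_)
open import Data.List.Membership.Propositional.Properties using
  (∈-filter⁺; ∈-filter⁻; ∈-cartesianProductWith⁺; ∈-allFin)
import Data.List.Relation.Unary.All as ListAll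
open import Data.List.Relation.Unary.All using ([]; _∷_)
open import Data.List.Relation.Unary.AllPairs using ([]; _∷_)
open import Data.List.Relation.Unary.Any using (here; there)
import Data.List.Relation.Unary.Unique.Propositional as ListUnique
import Data.List.Relation.Unary.Unique.Propositional.Properties as ListUnique
open import Data.Product using (∃; _×_; _,_; proj₁; proj₂)
open import Data.Sum using (_⊎_)
open import Data.Vec as Vec using (Vec; []; _∷_)
open import Data.Vec.Properties using (∷-injective)
open import Data.Vec.Relation.Binary.Pointwise.Inductive as Pointwise
  using (Pointwise; []; _∷_)
open import Data.Vec.Relation.Unary.All as All using (All; []; _∷_)
open import Data.Vec.Relation.Unary.AllPairs as AllPairs using (AllPairs; []; _∷_)
open import Data.Vec.Relation.Unary.Any as Any using (Any; here; there)
open import Data.Vec.Relation.Unary.Unique.Propositional using (Unique)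
open import Function using (_∘_; _⇔_; mk⇔; Equivalence)
open import Relation.Binary.PropositionalEquality using (_≡_; refl; sym; trans; cong₂)
open import Relation.Nullary using (Dec; yes; no; ¬_; contradiction)
open import Relation.Nullary.Decidable using (map′; ¬?; _×-dec_; _→-dec_; decidable-stable)
open import Relation.Unary using (Pred; Decidable)

private variable
  j k : ℕ

Point : ℕ → Set
Point j = Vec (Fin 3) j

Box : ℕ → Set
Box j = Vec (Subset 3) j

infix 4 _∈ᵇ_ _∈ᵇ?_

_∈ᵇ_ : Point j → Box j → Set
x ∈ᵇ B = Pointwise _∈ˢ_ x B

_∈ᵇ?_ : (x : Point j) (B : Box j) → Dec (x ∈ᵇ B)
_∈ᵇ?_ = Pointwise.decidable _∈?_

Proper : Box j → Set
Proper = All (λ s → Nonempty s × s ⊂ˢ full)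

Disjoint : Box j → Box j → Set
Disjoint B C = ∀ x → ¬ (x ∈ᵇ B × x ∈ᵇ C)

-- Disjointness of proper (hence nonempty) boxes forces them to be distinct,
-- so a vector of length k really counts k boxes.
record IsProperPartition {j k} (X : Pred (Point j) 0ℓ) (Bs : Vec (Box j) k) : Set where
  field
    proper   : All Proper Bs
    disjoint : AllPairs Disjoint Bs
    covers   : ∀ x → X x ⇔ Any (x ∈ᵇ_) Bs

PartitionedInto : Pred (Point j) 0ℓ → ℕ → Set
PartitionedInto {j} X k = ∃ λ (Bs : Vec (Box j) k) → IsProperPartition X Bs

IsMinimum : Pred ℕ 0ℓ → ℕ → Set
IsMinimum P n = P n × (∀ m → P m → n ≤ m)

allPairBox : Point j → Box j
allPairBox = Vec.map (λ a → ∁ ⁅ a ⁆)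

multiplicity : Vec (Point j) k → Point j → ℕ
multiplicity T x = Vec.count (λ t → x ∈ᵇ? allPairBox t) T

record Skeleton (j S c : ℕ) : Set where
  field
    T        : Vec (Point j) S
    distinct : Unique T

  N : Point j → ℕ
  N = multiplicity T

  Hole : Pred (Point j) 0ℓ
  Hole x = N x ≡ 0

  Support : Pred (Point j) 0ℓ
  Support x = N x ≡ 2

  field
    N∈0,2          : ∀ x → N x ≡ 0 ⊎ N x ≡ 2
    boxes          : Vec (Box j) c
    boxesPartition : IsProperPartition Hole boxes

  support? : Decidable Support
  support? x = N x ≟ 2

-- The minimum number of proper boxes partitioning a decidable set exists: the
-- set is partitioned by its singletons, and whether a partition into k proper
-- boxes exists is decided by exhaustive search.

private
  Searchable : Set → Set₁
  Searchable A = ∀ {P : Pred A 0ℓ} → Decidable P → Dec (∃ P)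

  anyVec? : ∀ {A n} → Searchable A → Searchable (Vec A n)
  anyVec? {n = zero}  s P? = map′ ([] ,_) (λ { ([] , p) → p }) (P? [])
  anyVec? {n = suc n} s P? =
    map′ (λ { (a , v , p) → a ∷ v , p }) (λ { (a ∷ v , p) → a , v , p })
         (s λ a → anyVec? s λ v → P? (a ∷ v))

  allPoints? : {P : Pred (Point j) 0ℓ} → Decidable P → Dec (∀ x → P x)
  allPoints? P? =
    map′ (λ ¬∃ x → decidable-stable (P? x) (λ ¬p → ¬∃ (x , ¬p)))
         (λ f (x , ¬p) → ¬p (f x))
         (¬? (anyVec? Fin.any? (¬? ∘ P?)))

  disjoint? : (B C : Box j) → Dec (Disjoint B C)
  disjoint? B C = allPoints? λ x → ¬? (x ∈ᵇ? B ×-dec x ∈ᵇ? C)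

  module _ {X : Pred (Point j) 0ℓ} (X? : Decidable X) where

    isProperPartition? : (Bs : Vec (Box j) k) → Dec (IsProperPartition X Bs)
    isProperPartition? Bs =
      map′ (λ (p , d , c) → record
              { proper = p ; disjoint = d
              ; covers = λ x → mk⇔ (proj₁ (c x)) (proj₂ (c x)) })
           (λ r → let open IsProperPartition r in
              proper , disjoint ,
              λ x → Equivalence.to (covers x) , Equivalence.from (covers x))
           (All.all? (All.all? (λ s → nonempty? s ×-dec (s ⊂? full))) Bs
             ×-dec AllPairs.allPairs? disjoint? Bs
             ×-dec allPoints? λ x →
               let c? = Any.any? (x ∈ᵇ?_) Bs in
               (X? x →-dec c?) ×-dec (c? →-dec X? x))

    partitionedInto? : Decidable (PartitionedInto X)
    partitionedInto? k = anyVec? (anyVec? anySubset?) isProperPartition?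

  points : ∀ j → List (Point j)
  points zero    = [] ∷ []
  points (suc j) = cartesianProductWith _∷_ (allFin 3) (points j)

  points-unique : ∀ j → ListUnique.Unique (points j)
  points-unique zero    = [] ∷ []
  points-unique (suc j) =
    ListUnique.cartesianProductWith⁺ _∷_ ∷-injective (ListUnique.allFin⁺ 3) (points-unique j)

  ∈-points : (x : Point j) → x ∈ points j
  ∈-points []      = here refl
  ∈-points (a ∷ x) = ∈-cartesianProductWith⁺ _∷_ (∈-allFin a) (∈-points x)

  singleton : Point j → Box j
  singleton = Vec.map ⁅_⁆

  ∈-singleton : (x : Point j) → x ∈ᵇ singleton x
  ∈-singleton []      = []
  ∈-singleton (a ∷ x) = x∈⁅x⁆ a ∷ ∈-singleton x

  ∈-singleton⁻ : {x : Point j} (y : Point j) → x ∈ᵇ singleton y → x ≡ y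
  ∈-singleton⁻ []      []      = refl
  ∈-singleton⁻ (b ∷ y) (p ∷ q) = cong₂ _∷_ (x∈⁅y⁆⇒x≡y b p) (∈-singleton⁻ y q)

  other : (a : Fin 3) → ∃ λ b → ¬ b ≡ a
  other Fin.zero    = Fin.suc Fin.zero , λ ()
  other (Fin.suc a) = Fin.zero , λ ()

  singleton-proper : (x : Point j) → Proper (singleton x)
  singleton-proper []      = []
  singleton-proper (a ∷ x) =
    ((a , x∈⁅x⁆ a) ,
     ((λ _ → ∈⊤) , proj₁ (other a) , ∈⊤ , λ m → proj₂ (other a) (x∈⁅y⁆⇒x≡y a m)))
    ∷ singleton-proper x

  singletons : (xs : List (Point j)) → Vec (Box j) (length xs)
  singletons xs = Vec.map singleton (Vec.fromList xs)

  singletons-proper : (xs : List (Point j)) → All Proper (singletons xs)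
  singletons-proper []       = []
  singletons-proper (x ∷ xs) = singleton-proper x ∷ singletons-proper xs

  singletons-apart : ∀ x (xs : List (Point j)) → ListAll.All (λ y → ¬ x ≡ y) xs →
                     All (Disjoint (singleton x)) (singletons xs)
  singletons-apart x []       []       = []
  singletons-apart x (y ∷ xs) (p ∷ ps) =
    (λ z (z∈x , z∈y) → p (trans (sym (∈-singleton⁻ x z∈x)) (∈-singleton⁻ y z∈y)))
    ∷ singletons-apart x xs ps

  singletons-disjoint : (xs : List (Point j)) → ListUnique.Unique xs →
                        AllPairs Disjoint (singletons xs)
  singletons-disjoint []       []       = []
  singletons-disjoint (x ∷ xs) (p ∷ ps) = singletons-apart x xs p ∷ singletons-disjoint xs ps

  ∈-singletons : {x : Point j} {xs : List (Point j)} → x ∈ xs → Any (x ∈ᵇ_) (singletons xs)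
  ∈-singletons {x = x} (here refl) = here (∈-singleton x)
  ∈-singletons         (there p)   = there (∈-singletons p)

  ∈-singletons⁻ : {x : Point j} (xs : List (Point j)) → Any (x ∈ᵇ_) (singletons xs) → x ∈ xs
  ∈-singletons⁻ (y ∷ xs) (here p)  = here (∈-singleton⁻ y p)
  ∈-singletons⁻ (y ∷ xs) (there p) = there (∈-singletons⁻ xs p)

  partitionExists : {X : Pred (Point j) 0ℓ} → Decidable X → ∃ (PartitionedInto X)
  partitionExists {j} X? = length xs , singletons xs , record
    { proper   = singletons-proper xs
    ; disjoint = singletons-disjoint xs (ListUnique.filter⁺ X? (points-unique j))
    ; covers   = λ x → mk⇔
        (λ Xx → ∈-singletons (∈-filter⁺ X? (∈-points x) Xx))
        (λ c → proj₂ (∈-filter⁻ X? {xs = points j} (∈-singletons⁻ xs c)))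
    }
    where xs = filter X? (points j)

  minimum : {P : Pred ℕ 0ℓ} → Decidable P → ∀ n → P n → ∃ (IsMinimum P)
  minimum P? n p with P? 0
  ... | yes p₀ = 0 , p₀ , λ _ _ → z≤n
  minimum P? zero    p | no ¬p₀ = 0 , p , λ _ _ → z≤n
  minimum P? (suc n) p | no ¬p₀ with minimum (λ m → P? (suc m)) n p
  ... | m , q , least = suc m , q , λ
    { zero    p₀ → contradiction p₀ ¬p₀
    ; (suc i) pᵢ → s≤s (least i pᵢ) }

minPartition : {X : Pred (Point j) 0ℓ} → Decidable X → ∃ (IsMinimum (PartitionedInto X))
minPartition X? =
  minimum (partitionedInto? X?) (proj₁ (partitionExists X?)) (proj₂ (partitionExists X?))

partitionNumber : (X : Pred (Point j) 0ℓ) → Decidable X → ℕ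
partitionNumber X X? = proj₁ (minPartition X?)

{-# OPTIONS --safe #-}

-- A partition of U into proper boxes together with the given partition of the
-- hole-set covers every point exactly once, so it suffices to bound below the
-- size of a family of proper boxes covering every point an odd number of times.
-- Induct on the dimension.  For an odd-sized R ⊆ [3], the boxes whose first
-- factor meets R in an odd number of elements, with that factor dropped, again
-- form an odd cover, so there are at least 2 ^ (j − 1) of them.  [3] has four
-- odd-sized subsets, and a nonempty proper subset of [3] has odd intersection
-- with exactly two of them; hence 2 k ≥ 4 · 2 ^ (j − 1).
module Submission where

open import Defs
open import Data.Nat using (ℕ; zero; suc; _+_; _*_; _^_; _≤_; _≥_; z≤n; s≤s)
import Data.Nat.Properties as ℕ
open import Data.Nat.Solver using () renaming (module +-*-Solver to ℕ-Solver)
open import Data.Integer as ℤ using (+_)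
import Data.Integer.Properties as ℤ
open import Data.Integer.Solver using () renaming (module +-*-Solver to ℤ-Solver)
open import Data.Bool using (Bool; true; false; _∧_; _xor_; if_then_else_)
open import Data.Bool.Properties using
  (xor-assoc; ∧-distribʳ-xor; xor-∧-commutativeRing)
open import Algebra.Bundles using (CommutativeMonoid; CommutativeRing)
import Algebra.Properties.CommutativeSemigroup as CommutativeSemigroupProperties
open import Data.Fin using (Fin; zero; suc)
open import Data.Fin.Subset using (Subset; Nonempty) renaming (_⊂_ to _⊂ˢ_; ⊤ to full)
open import Data.Fin.Subset.Properties using (_∈?_; ∈⊤)
open import Data.List using (List; []; _∷_; _++_; length)
open import Data.List.Properties using (length-++)
open import Data.List.Relation.Unary.All as ListAll using ([]; _∷_)
import Data.List.Relation.Unary.All.Properties as ListAll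
open import Data.Product using (_×_; _,_; proj₁; proj₂)
open import Data.Sum using (inj₁; inj₂)
open import Data.Vec using (Vec; []; _∷_; there; toList)
open import Data.Vec.Properties using (length-toList)
open import Data.Vec.Relation.Unary.All as All using (All; []; _∷_)
open import Data.Vec.Relation.Unary.All.Properties using (toList⁺)
open import Data.Vec.Relation.Unary.AllPairs using (AllPairs; []; _∷_)
open import Data.Vec.Relation.Unary.Any using (Any; here; there)
open import Function using (_∘_; Equivalence)
open import Relation.Binary.PropositionalEquality
open import Relation.Nullary using (¬_; does; contradiction)
open import Relation.Nullary.Decidable using (dec-true; dec-false)

-- Sums over the two-element field, indexed by lists.

⨁ : {A : Set} → List A → (A → Bool) → Bool
⨁ []       f = false
⨁ (a ∷ as) f = f a xor ⨁ as f

⨁-cong : ∀ {A : Set} (as : List A) {f g : A → Bool} → (∀ a → f a ≡ g a) → ⨁ as f ≡ ⨁ as g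
⨁-cong []       f≗g = refl
⨁-cong (a ∷ as) f≗g = cong₂ _xor_ (f≗g a) (⨁-cong as f≗g)

⨁-false : ∀ {A : Set} (as : List A) → ⨁ as (λ _ → false) ≡ false
⨁-false []       = refl
⨁-false (a ∷ as) = ⨁-false as

⨁-xor : ∀ {A : Set} (as : List A) (f g : A → Bool) →
        ⨁ as (λ a → f a xor g a) ≡ ⨁ as f xor ⨁ as g
⨁-xor []       f g = refl
⨁-xor (a ∷ as) f g =
  trans (cong ((f a xor g a) xor_) (⨁-xor as f g))
        (interchange (f a) (g a) (⨁ as f) (⨁ as g))
  where
  open CommutativeRing xor-∧-commutativeRing using (+-commutativeMonoid)
  open CommutativeSemigroupProperties
    (CommutativeMonoid.commutativeSemigroup +-commutativeMonoid) using (interchange)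

⨁-∧ : ∀ {A : Set} (as : List A) (f : A → Bool) b → ⨁ as (λ a → f a ∧ b) ≡ ⨁ as f ∧ b
⨁-∧ []       f b = refl
⨁-∧ (a ∷ as) f b =
  trans (cong ((f a ∧ b) xor_) (⨁-∧ as f b)) (sym (∧-distribʳ-xor b (f a) (⨁ as f)))

⨁-++ : ∀ {A : Set} (as bs : List A) (f : A → Bool) → ⨁ (as ++ bs) f ≡ ⨁ as f xor ⨁ bs f
⨁-++ []       bs f = refl
⨁-++ (a ∷ as) bs f =
  trans (cong (f a xor_) (⨁-++ as bs f)) (sym (xor-assoc (f a) (⨁ as f) (⨁ bs f)))

-- Odd covers and their slices.

coverParity : ∀ {j} → List (Box j) → Point j → Bool
coverParity Bs x = ⨁ Bs (λ B → does (x ∈ᵇ? B))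

OddCover : ∀ {j} → List (Box j) → Set
OddCover Bs = ∀ x → coverParity Bs x ≡ true

-- R is a duplicate-free list of coordinates, standing for a subset of [3].
oddMeet : List (Fin 3) → Subset 3 → Bool
oddMeet R s = ⨁ R (λ a → does (a ∈? s))

slice : ∀ {j} → List (Fin 3) → List (Box (suc j)) → List (Box j)
slice R []             = []
slice R ((s ∷ B) ∷ Bs) = if oddMeet R s then B ∷ slice R Bs else slice R Bs

slice-proper : ∀ {j} R {Bs : List (Box (suc j))} →
               ListAll.All Proper Bs → ListAll.All Proper (slice R Bs)
slice-proper R []                                    = []
slice-proper R (_∷_ {x = s ∷ B} (_ ∷ proper) propers) with oddMeet R s
... | true  = proper ∷ slice-proper R propers
... | false = slice-proper R propers

-- Exchange of two sums modulo 2. Summing over `a` in `R` the membership of `a ∷ x` in `s ∷ B`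
-- leaves the membership of `x` in `B` multiplied by `oddMeet R s`, which is exactly the weight, 0
-- or 1, that `slice` gives to `B`.
coverParity-slice : ∀ {j} R (Bs : List (Box (suc j))) (x : Point j) →
                    coverParity (slice R Bs) x ≡ ⨁ R (λ a → coverParity Bs (a ∷ x))
coverParity-slice R []             x = sym (⨁-false R)
coverParity-slice R ((s ∷ B) ∷ Bs) x = begin
  coverParity (slice R ((s ∷ B) ∷ Bs)) x
    ≡⟨ head-slice (oddMeet R s) ⟩
  (oddMeet R s ∧ does (x ∈ᵇ? B)) xor coverParity (slice R Bs) x
    -- Membership of `a ∷ x` in `s ∷ B` computes to a conjunction of the two factors, so pulling the
    -- constant factor back inside the sum already has the form of the next line.
    ≡⟨ cong₂ _xor_ (sym (⨁-∧ R _ (does (x ∈ᵇ? B)))) (coverParity-slice R Bs x) ⟩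
  ⨁ R (λ a → does ((a ∷ x) ∈ᵇ? (s ∷ B))) xor ⨁ R (λ a → coverParity Bs (a ∷ x))
    ≡⟨ sym (⨁-xor R _ _) ⟩
  ⨁ R (λ a → coverParity ((s ∷ B) ∷ Bs) (a ∷ x)) ∎
  where
  open ≡-Reasoning
  head-slice : ∀ b → coverParity (if b then B ∷ slice R Bs else slice R Bs) x
                     ≡ (b ∧ does (x ∈ᵇ? B)) xor coverParity (slice R Bs) x
  head-slice true  = refl
  head-slice false = refl

-- The sum of `true` over `R` is the parity of its length, so the hypothesis says that `R` has odd
-- size. Every term on the right of `coverParity-slice` is `true`, and an odd number of them sums to
-- `true`.
slice-oddCover : ∀ {j} R (Bs : List (Box (suc j))) → ⨁ R (λ _ → true) ≡ true →
                 OddCover Bs → OddCover (slice R Bs)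
slice-oddCover R Bs R-odd cover x =
  trans (coverParity-slice R Bs x) (trans (⨁-cong R (λ a → cover (a ∷ x))) R-odd)

-- Counting over the four odd-sized subsets.

R₀ R₁ R₂ R₀₁₂ : List (Fin 3)
R₀   = zero ∷ []
R₁   = suc zero ∷ []
R₂   = suc (suc zero) ∷ []
R₀₁₂ = zero ∷ suc zero ∷ suc (suc zero) ∷ []

overOddSets : (List (Fin 3) → ℕ) → ℕ
overOddSets f = f R₀ + f R₁ + f R₂ + f R₀₁₂

indicator : Bool → ℕ
indicator b = if b then 1 else 0

-- The parity of the intersection with `s` is linear in `R`, and on the odd-sized `R` it is constant
-- only for `s` empty (total 0) or full (total 4). The hypotheses exclude precisely these; the
-- remaining six cases compute.
proper-meets-two : ∀ s → Nonempty s → s ⊂ˢ full → overOddSets (λ R → indicator (oddMeet R s)) ≡ 2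
proper-meets-two (false ∷ false ∷ false ∷ []) (zero , ()) _
proper-meets-two (false ∷ false ∷ false ∷ []) (suc zero , there ()) _
proper-meets-two (false ∷ false ∷ false ∷ []) (suc (suc zero) , there (there ())) _
proper-meets-two (true  ∷ false ∷ false ∷ []) _ _ = refl
proper-meets-two (false ∷ true  ∷ false ∷ []) _ _ = refl
proper-meets-two (false ∷ false ∷ true  ∷ []) _ _ = refl
proper-meets-two (true  ∷ true  ∷ false ∷ []) _ _ = refl
proper-meets-two (true  ∷ false ∷ true  ∷ []) _ _ = refl
proper-meets-two (false ∷ true  ∷ true  ∷ []) _ _ = refl
proper-meets-two (true  ∷ true  ∷ true  ∷ []) _ (_ , _ , _ , ∉full) = contradiction ∈⊤ ∉full

length-slice-∷ : ∀ {j} R s (B : Box j) Bs →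
                 length (slice R ((s ∷ B) ∷ Bs)) ≡ indicator (oddMeet R s) + length (slice R Bs)
length-slice-∷ R s B Bs with oddMeet R s
... | true  = refl
... | false = refl

-- Double counting: each box survives in exactly two of the four slices.
slices-length : ∀ {j} {Bs : List (Box (suc j))} → ListAll.All Proper Bs →
                overOddSets (λ R → length (slice R Bs)) ≡ 2 * length Bs
slices-length [] = refl
slices-length {Bs = (s ∷ B) ∷ Bs} (((nonempty , proper) ∷ _) ∷ propers) = begin
  overOddSets (λ R → length (slice R ((s ∷ B) ∷ Bs)))
    ≡⟨ cong₂ _+_ (cong₂ _+_ (cong₂ _+_ (unfold R₀) (unfold R₁)) (unfold R₂)) (unfold R₀₁₂) ⟩
  overOddSets (λ R → indicator (oddMeet R s) + length (slice R Bs))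
    ≡⟨ regroup (indicator (oddMeet R₀ s)) (indicator (oddMeet R₁ s))
               (indicator (oddMeet R₂ s)) (indicator (oddMeet R₀₁₂ s))
               (length (slice R₀ Bs)) (length (slice R₁ Bs))
               (length (slice R₂ Bs)) (length (slice R₀₁₂ Bs)) ⟩
  overOddSets (λ R → indicator (oddMeet R s)) + overOddSets (λ R → length (slice R Bs))
    ≡⟨ cong₂ _+_ (proper-meets-two s nonempty proper) (slices-length propers) ⟩
  2 + 2 * length Bs
    ≡⟨ sym (ℕ.*-suc 2 (length Bs)) ⟩
  2 * suc (length Bs) ∎
  where
  open ≡-Reasoning
  unfold : ∀ R → length (slice R ((s ∷ B) ∷ Bs)) ≡ indicator (oddMeet R s) + length (slice R Bs)
  unfold R = length-slice-∷ R s B Bs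
  regroup : ∀ a b c d a′ b′ c′ d′ → (a + a′) + (b + b′) + (c + c′) + (d + d′)
                                    ≡ (a + b + c + d) + (a′ + b′ + c′ + d′)
  regroup = solve 8 (λ a b c d a′ b′ c′ d′ → (a :+ a′) :+ (b :+ b′) :+ (c :+ c′) :+ (d :+ d′)
                                    := (a :+ b :+ c :+ d) :+ (a′ :+ b′ :+ c′ :+ d′)) refl
    where open ℕ-Solver

oddCover-size : ∀ {j} (Bs : List (Box j)) → ListAll.All Proper Bs → OddCover Bs → 2 ^ j ≤ length Bs
-- In dimension 0 the bound is 1: the only point has to be covered, so the list cannot be empty.
oddCover-size {zero}  []       _       cover = contradiction (cover []) λ ()
oddCover-size {zero}  (_ ∷ _)  _       _     = s≤s z≤n
-- The goal is doubled because the four slices together count every box twice.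
oddCover-size {suc j} Bs       propers cover = ℕ.*-cancelˡ-≤ 2 (begin
  2 * (2 * 2 ^ j)
    ≡⟨ solve 1 (λ n → con 2 :* (con 2 :* n) := n :+ n :+ n :+ n) refl (2 ^ j) ⟩
  overOddSets (λ _ → 2 ^ j)
    ≤⟨ ℕ.+-mono-≤ (ℕ.+-mono-≤ (ℕ.+-mono-≤ (bound R₀ refl) (bound R₁ refl)) (bound R₂ refl))
                  (bound R₀₁₂ refl) ⟩
  overOddSets (λ R → length (slice R Bs))
    ≡⟨ slices-length propers ⟩
  2 * length Bs ∎)
  where
  open ℕ.≤-Reasoning
  open ℕ-Solver
  bound : ∀ R → ⨁ R (λ _ → true) ≡ true → 2 ^ j ≤ length (slice R Bs)
  bound R R-odd = oddCover-size (slice R Bs) (slice-proper R propers) (slice-oddCover R Bs R-odd cover)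

-- Cover parity of a disjoint family.

coverParity-outside : ∀ {j k} (Bs : Vec (Box j) k) {x} → ¬ Any (x ∈ᵇ_) Bs →
                      coverParity (toList Bs) x ≡ false
coverParity-outside []       _    = refl
coverParity-outside (B ∷ Bs) {x} x∉ =
  cong₂ _xor_ (dec-false (x ∈ᵇ? B) (x∉ ∘ here)) (coverParity-outside Bs (x∉ ∘ there))

disjoint-∉ : ∀ {j k} {B : Box j} {Bs : Vec (Box j) k} {x} →
             All (Disjoint B) Bs → x ∈ᵇ B → ¬ Any (x ∈ᵇ_) Bs
disjoint-∉ (B#C ∷ _)  x∈B (here x∈C)   = B#C _ (x∈B , x∈C)
disjoint-∉ (_ ∷ B#Bs) x∈B (there x∈Bs) = disjoint-∉ B#Bs x∈B x∈Bs

-- Disjointness leaves exactly one box containing `x`: that box contributes `true`, all others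
-- `false`.
coverParity-inside : ∀ {j k} {Bs : Vec (Box j) k} {x} → AllPairs Disjoint Bs →
                     Any (x ∈ᵇ_) Bs → coverParity (toList Bs) x ≡ true
coverParity-inside {Bs = B ∷ Bs} {x} (B#Bs ∷ _) (here x∈B) =
  cong₂ _xor_ (dec-true (x ∈ᵇ? B) x∈B) (coverParity-outside Bs (disjoint-∉ B#Bs x∈B))
coverParity-inside {Bs = B ∷ Bs} {x} (B#Bs ∷ Bs#) (there x∈Bs) =
  cong₂ _xor_ (dec-false (x ∈ᵇ? B) (λ x∈B → disjoint-∉ B#Bs x∈B x∈Bs)) (coverParity-inside Bs# x∈Bs)

-- The inequalities for skeletons.

support+holes≥ : ∀ {j S c p} (K : Skeleton j S c) → PartitionedInto (Skeleton.Support K) p →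
                 p + c ≥ 2 ^ j
support+holes≥ {j} {S} {c} {p} K (Us , usPartition) =
  subst (2 ^ j ≤_) size
    (oddCover-size (toList Us ++ toList boxes)
      (ListAll.++⁺ (toList⁺ U.proper) (toList⁺ H.proper)) cover)
  where
  open Skeleton K
  module U = IsProperPartition usPartition
  module H = IsProperPartition boxesPartition

  size : length (toList Us ++ toList boxes) ≡ p + c
  size = trans (length-++ (toList Us)) (cong₂ _+_ (length-toList Us) (length-toList boxes))

  0≢2 : ∀ {n : ℕ} → n ≡ 0 → ¬ n ≡ 2
  0≢2 refl ()

  cover : OddCover (toList Us ++ toList boxes)
  -- As `N x` is 0 or 2, the point lies in exactly one of hole-set and support, so exactly one of
  -- the two parities is `true`.
  cover x = trans (⨁-++ (toList Us) (toList boxes) _) (split (N∈0,2 x))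
    where
    split : _ → coverParity (toList Us) x xor coverParity (toList boxes) x ≡ true
    split (inj₁ N≡0) = cong₂ _xor_
      (coverParity-outside Us (0≢2 N≡0 ∘ Equivalence.from (U.covers x)))
      (coverParity-inside H.disjoint (Equivalence.to (H.covers x) N≡0))
    split (inj₂ N≡2) = cong₂ _xor_
      (coverParity-inside U.disjoint (Equivalence.to (U.covers x) N≡2))
      (coverParity-outside boxes (λ x∈ → 0≢2 (Equivalence.from (H.covers x) x∈) N≡2))

-- Adds `S - p` to both sides. This takes place in the integers, where the difference may be
-- negative and is not truncated.
+-rearrange-≥ : ∀ S c p n → p + c ≥ n → + S ℤ.+ + c ℤ.≥ + n ℤ.+ (+ S ℤ.- + p)
+-rearrange-≥ S c p n p+c≥n = begin
  + n ℤ.+ (+ S ℤ.- + p)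
    ≤⟨ ℤ.+-monoˡ-≤ (+ S ℤ.- + p) (ℤ.+≤+ p+c≥n) ⟩
  (+ p ℤ.+ + c) ℤ.+ (+ S ℤ.- + p)
    ≡⟨ solve 3 (λ p c s → (p :+ c) :+ (s :- p) := s :+ c) refl (+ p) (+ c) (+ S) ⟩
  + S ℤ.+ + c ∎
  where
  open ℤ.≤-Reasoning
  open ℤ-Solver

proposition8p2 : ∀ {j S c : ℕ} (K : Skeleton j S c) →
    let p = partitionNumber (Skeleton.Support K) (Skeleton.support? K) in
    (p + c ≥ 2 ^ j)
    × (+ S ℤ.+ + c ℤ.≥ + (2 ^ j) ℤ.+ (+ S ℤ.- + p))
    × (S + c ≤ 2 ^ j → p ≥ S)
proposition8p2 {j} {S} {c} K =
  p+c≥2^j , +-rearrange-≥ S c p (2 ^ j) p+c≥2^j ,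
  λ S+c≤2^j → ℕ.+-cancelʳ-≤ c S p (ℕ.≤-trans S+c≤2^j p+c≥2^j)
  where
  p : ℕ
  p = partitionNumber (Skeleton.Support K) (Skeleton.support? K)
  p+c≥2^j : p + c ≥ 2 ^ j
  -- The minimum is attained: its first component is a partition of the support into exactly `p`
  -- boxes.
  p+c≥2^j = support+holes≥ K (proj₁ (proj₂ (minPartition (Skeleton.support? K))))
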